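{- Let $r > 1$ and $k \geq 1$ be integers with $W(r,k) > \max(\{r,k\})$, and let $n$ be the exponent of the leading power of $r$ in the base-$r$ expansion of $W(r,k)$. Then $$n > \frac{\log W(r,k)}{\log r} - 1.$$
   Context: For positive integers $r, k$, the van der Waerden number $W(r,k)$ is the least positive integer $N$ such that every coloring of the integer interval $[1,N]=\{1,\dots,N\}$ with $r$ colors contains a monochromatic arithmetic progression of $k$ terms. For $W(r,k) > r > 1$, write the base-$r$ expansion $W(r,k) = b_{n}r^{n} + b_{n-1}r^{n-1} + \cdots + b_{0}$ with integers $1 \leq b_n \leq r-1$ and $0 \leq b_i \leq r-1$ for $i<n$; the exponent of the leading power is this $n$, equivalently the unique integer with $r^{n} \leq W(r,k) < r^{n+1}$. -}

module Defs where

open import Data.Nat.Base as ℕ using (ℕ; zero; suc; z≤n; s≤s)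
import Data.Nat.Properties as ℕ
import Data.Integer.Base as ℤ
import Data.Integer.Properties as ℤ
open import Data.Nat.Coprimality using (1-coprimeTo) renaming (sym to coprime-sym)
open import Data.Fin.Base as Fin using (Fin; toℕ)
open import Data.Product using (∃-syntax; _×_; _,_)
open import Data.Rational.Base as ℚ
  using (ℚ; mkℚ; 0ℚ; 1ℚ; _+_; _*_; _-_; -_; 1/_; ∣_∣; _≤_; _<_; Positive; NonNegative; *≤*)
open import Data.Rational.Properties
import Data.Rational.Unnormalised.Base as ℚᵘ
import Data.Rational.Unnormalised.Properties as ℚᵘ
open import Data.Rational.Solver using (module +-*-Solver)
open import Data.Sum.Base using (inj₁; inj₂)
open import Relation.Binary.PropositionalEquality
  using (_≡_; refl; sym; trans; cong; cong₂; subst; subst₂; module ≡-Reasoning)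
open import Algebra.Properties.Monoid.Sum ℕ.+-0-monoid using (sum-syntax)
open +-*-Solver using (solve; _:=_; _:+_; _:*_; :-_; _:-_; con)

-- A point i : Fin N stands for the integer suc (toℕ i) of [1,N].
Coloring : ℕ → ℕ → Set
Coloring N r = Fin N → Fin r

IsProgression : ∀ {N} k → (Fin k → Fin N) → Set
IsProgression k t =
  ∃[ a ] ∃[ d ] (1 ℕ.≤ d) × (∀ i → suc (toℕ (t i)) ≡ a ℕ.+ toℕ i ℕ.* d)

Monochromatic : ∀ {N r} k → Coloring N r → (Fin k → Fin N) → Set
Monochromatic k c t = ∃[ colour ] ∀ (i : Fin k) → c (t i) ≡ colour

VanDerWaerdenProperty : ℕ → ℕ → ℕ → Set
VanDerWaerdenProperty r k N =
  ∀ (c : Coloring N r) → ∃[ t ] IsProgression k t × Monochromatic k c t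

-- W(r,k) = W, as a relation: the library has no van der Waerden theorem from
-- which to obtain W(r,k) as a total function.
IsVanDerWaerdenNumber : ℕ → ℕ → ℕ → Set
IsVanDerWaerdenNumber r k W =
  (1 ℕ.≤ W) × VanDerWaerdenProperty r k W ×
  (∀ N → 1 ℕ.≤ N → VanDerWaerdenProperty r k N → W ℕ.≤ N)

IsExpansion : (r W n : ℕ) → (Fin (suc n) → Fin r) → Set
IsExpansion r W n b =
  (1 ℕ.≤ toℕ (b (Fin.fromℕ n))) ×
  (W ≡ ∑[ i < suc n ] (toℕ (b i) ℕ.* r ℕ.^ toℕ i))

IsLeadingExponent : (r W n : ℕ) → Set
IsLeadingExponent r W n = ∃[ b ] IsExpansion r W n b

Cauchy : (ℕ → ℚ) → Set
Cauchy x = ∀ ε → 0ℚ < ε →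
  ∃[ N ] ∀ m n → N ℕ.≤ m → N ℕ.≤ n → ∣ x m - x n ∣ < ε

-- Two sequences with the same limit are distinct elements of ℝ; _<ℝ_ depends only
-- on the limits.
record ℝ : Set where
  constructor mkℝ
  field
    seq    : ℕ → ℚ
    cauchy : Cauchy seq
open ℝ public

infix 4 _<ℝ_
_<ℝ_ : ℝ → ℝ → Set
x <ℝ y = ∃[ δ ] (0ℚ < δ) × ∃[ N ] ∀ n → N ℕ.≤ n → seq x n + δ ≤ seq y n

fromℚ : ℚ → ℝ
fromℚ q = mkℝ (λ _ → q) λ ε 0<ε → 0 , λ _ _ _ _ →
  subst (_< ε) (sym (cong ∣_∣ (+-inverseʳ q))) 0<ε

fromℕ : ℕ → ℝ
fromℕ n = fromℚ (ℤ.+ n ℚ./ 1)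

0ℝ 1ℝ : ℝ
0ℝ = fromℚ 0ℚ
1ℝ = fromℚ 1ℚ

private
  telescope : ∀ a b → a ≡ (a - b) + b
  telescope = solve 2 (λ a b → a := (a :- b) :+ b) refl

  swap-diff : ∀ a b → - (a - b) ≡ b - a
  swap-diff = solve 2 (λ a b → :- (a :- b) := b :- a) refl

  neg-diff : ∀ a b → - (a - b) ≡ - a - - b
  neg-diff = solve 2 (λ a b → :- (a :- b) := :- a :- :- b) refl

  sum-diff : ∀ a b c d → (a + b) - (c + d) ≡ (a - c) + (b - d)
  sum-diff = solve 4 (λ a b c d → (a :+ b) :- (c :+ d) := (a :- c) :+ (b :- d)) refl

  product-diff : ∀ a b c d → a * b - c * d ≡ a * (b - d) + d * (a - c)
  product-diff = solve 4 (λ a b c d → a :* b :- c :* d := a :* (b :- d) :+ d :* (a :- c)) refl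

  inverse-diff : ∀ a b u v → (b * v) * u - (a * u) * v ≡ (b - a) * (u * v)
  inverse-diff = solve 4 (λ a b u v → (b :* v) :* u :- (a :* u) :* v := (b :- a) :* (u :* v)) refl

  regroup : ∀ ε a b u v → ε * (a * b) * (u * v) ≡ ε * ((a * u) * (b * v))
  regroup = solve 5 (λ ε a b u v → ε :* (a :* b) :* (u :* v) := ε :* ((a :* u) :* (b :* v))) refl

  one-more : ∀ c i → c + i * c ≡ (1ℚ + i) * c
  one-more = solve 2 (λ c i → c :+ i :* c := (con 1ℚ :+ i) :* c) refl

  cancel : ∀ r s → (r + s) - s ≡ r
  cancel = solve 2 (λ r s → (r :+ s) :- s := r) refl

*-pos : ∀ {p q} → 0ℚ < p → 0ℚ < q → 0ℚ < p * q
*-pos {p} {q} 0<p 0<q =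
  positive⁻¹ (p * q) {{pos*pos⇒pos p {{ℚ.positive 0<p}} q {{ℚ.positive 0<q}}}}

1/-pos : ∀ {p} (0<p : 0ℚ < p) → 0ℚ < (1/ p) {{ℚ.>-nonZero 0<p}}
1/-pos {p} 0<p = positive⁻¹ _ {{1/pos⇒pos p {{ℚ.positive 0<p}}}}

+-pos : ∀ {p q} → 0ℚ < p → 0ℚ < q → 0ℚ < p + q
+-pos = +-mono-<

*-mono-≤-nonNeg : ∀ {p q u v} → 0ℚ ≤ q → 0ℚ ≤ u → p ≤ q → u ≤ v → p * u ≤ q * v
*-mono-≤-nonNeg {p} {q} {u} {v} 0≤q 0≤u p≤q u≤v = ≤-trans
  (*-monoʳ-≤-nonNeg u {{ℚ.nonNegative 0≤u}} p≤q)
  (*-monoˡ-≤-nonNeg q {{ℚ.nonNegative 0≤q}} u≤v)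

eventually-bounded : ∀ {x} → Cauchy x →
  ∃[ B ] (0ℚ < B) × ∃[ N ] ∀ n → N ℕ.≤ n → ∣ x n ∣ ≤ B
eventually-bounded {x} cx with cx 1ℚ (positive⁻¹ 1ℚ)
... | N , close = 1ℚ + ∣ x N ∣ , +-mono-<-≤ (positive⁻¹ 1ℚ) (0≤∣p∣ (x N)) , N , bound
  where
  open ≤-Reasoning
  bound : ∀ n → N ℕ.≤ n → ∣ x n ∣ ≤ 1ℚ + ∣ x N ∣
  bound n N≤n = begin
    ∣ x n ∣                     ≡⟨ cong ∣_∣ (telescope (x n) (x N)) ⟩
    ∣ (x n - x N) + x N ∣       ≤⟨ ∣p+q∣≤∣p∣+∣q∣ (x n - x N) (x N) ⟩
    ∣ x n - x N ∣ + ∣ x N ∣     ≤⟨ +-monoˡ-≤ ∣ x N ∣ (<⇒≤ (close n N N≤n ℕ.≤-refl)) ⟩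
    1ℚ + ∣ x N ∣                ∎

-ℝ_ : ℝ → ℝ
-ℝ x = mkℝ (λ n → - seq x n) λ ε 0<ε →
  let N , close = cauchy x ε 0<ε in
  N , λ m n N≤m N≤n →
    subst (_< ε)
      (trans (sym (∣-p∣≡∣p∣ (seq x m - seq x n)))
        (cong ∣_∣ (neg-diff (seq x m) (seq x n))))
      (close m n N≤m N≤n)

infixl 6 _+ℝ_ _-ℝ_
_+ℝ_ : ℝ → ℝ → ℝ
x +ℝ y = mkℝ (λ n → seq x n + seq y n) proof
  where
  open ≤-Reasoning
  proof : Cauchy (λ n → seq x n + seq y n)
  proof ε 0<ε with cauchy x (ε * ℚ.½) (*-pos 0<ε (positive⁻¹ ℚ.½))
                 | cauchy y (ε * ℚ.½) (*-pos 0<ε (positive⁻¹ ℚ.½))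
  ... | M , closeˣ | N , closeʸ = M ℕ.⊔ N , λ m n p q → begin-strict
    ∣ (seq x m + seq y m) - (seq x n + seq y n) ∣
      ≡⟨ cong ∣_∣ (sum-diff (seq x m) (seq y m) (seq x n) (seq y n)) ⟩
    ∣ (seq x m - seq x n) + (seq y m - seq y n) ∣
      ≤⟨ ∣p+q∣≤∣p∣+∣q∣ (seq x m - seq x n) (seq y m - seq y n) ⟩
    ∣ seq x m - seq x n ∣ + ∣ seq y m - seq y n ∣
      <⟨ +-mono-< (closeˣ m n (ℕ.m⊔n≤o⇒m≤o M N p) (ℕ.m⊔n≤o⇒m≤o M N q))
                  (closeʸ m n (ℕ.m⊔n≤o⇒n≤o M N p) (ℕ.m⊔n≤o⇒n≤o M N q)) ⟩
    ε * ℚ.½ + ε * ℚ.½  ≡⟨ sym (*-distribˡ-+ ε ℚ.½ ℚ.½) ⟩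
    ε * 1ℚ             ≡⟨ *-identityʳ ε ⟩
    ε                  ∎

_-ℝ_ : ℝ → ℝ → ℝ
x -ℝ y = x +ℝ (-ℝ y)

scale : ∀ {ε S} → 0ℚ < ε → 0ℚ < S → ∃[ η ] (0ℚ < η) × (S * η ≡ ε)
scale {ε} {S} 0<ε 0<S = ε * S⁻¹ , *-pos 0<ε (1/-pos 0<S) ,
  trans (rotate S ε S⁻¹) (trans (cong (ε *_) (*-inverseʳ S {{ℚ.>-nonZero 0<S}})) (*-identityʳ ε))
  where
  S⁻¹ : ℚ
  S⁻¹ = (1/ S) {{ℚ.>-nonZero 0<S}}
  rotate : ∀ S ε i → S * (ε * i) ≡ ε * (S * i)
  rotate = solve 3 (λ S ε i → S :* (ε :* i) := ε :* (S :* i)) refl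

product-close : ∀ {A B η} a b c d → 0ℚ < A → 0ℚ < B → ∣ a ∣ ≤ A → ∣ d ∣ ≤ B →
  ∣ b - d ∣ < η → ∣ a - c ∣ < η → ∣ a * b - c * d ∣ < (A + B) * η
product-close {A} {B} {η} a b c d 0<A 0<B a≤A d≤B bd ac = begin-strict
  ∣ a * b - c * d ∣
    ≡⟨ cong ∣_∣ (product-diff a b c d) ⟩
  ∣ a * (b - d) + d * (a - c) ∣
    ≤⟨ ∣p+q∣≤∣p∣+∣q∣ (a * (b - d)) (d * (a - c)) ⟩
  ∣ a * (b - d) ∣ + ∣ d * (a - c) ∣
    ≡⟨ cong₂ _+_ (∣p*q∣≡∣p∣*∣q∣ a (b - d)) (∣p*q∣≡∣p∣*∣q∣ d (a - c)) ⟩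
  ∣ a ∣ * ∣ b - d ∣ + ∣ d ∣ * ∣ a - c ∣
    ≤⟨ +-mono-≤
         (*-monoʳ-≤-nonNeg ∣ b - d ∣ {{∣-∣-nonNeg (b - d)}} a≤A)
         (*-monoʳ-≤-nonNeg ∣ a - c ∣ {{∣-∣-nonNeg (a - c)}} d≤B) ⟩
  A * ∣ b - d ∣ + B * ∣ a - c ∣
    <⟨ +-mono-< (*-monoʳ-<-pos A {{ℚ.positive 0<A}} bd) (*-monoʳ-<-pos B {{ℚ.positive 0<B}} ac) ⟩
  A * η + B * η
    ≡⟨ sym (*-distribʳ-+ η A B) ⟩
  (A + B) * η ∎
  where open ≤-Reasoning

EventuallyBoundedBy : (ℕ → ℚ) → ℚ → ℕ → Set
EventuallyBoundedBy x B N = ∀ n → N ℕ.≤ n → ∣ x n ∣ ≤ B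

CloseFrom : (ℕ → ℚ) → ℚ → ℕ → Set
CloseFrom x ε N = ∀ m n → N ℕ.≤ m → N ℕ.≤ n → ∣ x m - x n ∣ < ε

product-closeFrom : ∀ {x y A B K L M N η} → 0ℚ < A → 0ℚ < B →
  EventuallyBoundedBy x A K → EventuallyBoundedBy y B L →
  CloseFrom x η M → CloseFrom y η N →
  CloseFrom (λ n → x n * y n) ((A + B) * η) (K ℕ.⊔ L ℕ.⊔ (M ℕ.⊔ N))
product-closeFrom {x} {y} {K = K} {L} {M} {N} 0<A 0<B boundˣ boundʸ closeˣ closeʸ m n p q =
  product-close (x m) (y m) (x n) (y n) 0<A 0<B
    (boundˣ m (ℕ.m⊔n≤o⇒m≤o K L (left p)))
    (boundʸ n (ℕ.m⊔n≤o⇒n≤o K L (left q)))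
    (closeʸ m n (ℕ.m⊔n≤o⇒n≤o M N (right p)) (ℕ.m⊔n≤o⇒n≤o M N (right q)))
    (closeˣ m n (ℕ.m⊔n≤o⇒m≤o M N (right p)) (ℕ.m⊔n≤o⇒m≤o M N (right q)))
  where
  left : ∀ {i} → K ℕ.⊔ L ℕ.⊔ (M ℕ.⊔ N) ℕ.≤ i → K ℕ.⊔ L ℕ.≤ i
  left = ℕ.m⊔n≤o⇒m≤o (K ℕ.⊔ L) (M ℕ.⊔ N)
  right : ∀ {i} → K ℕ.⊔ L ℕ.⊔ (M ℕ.⊔ N) ℕ.≤ i → M ℕ.⊔ N ℕ.≤ i
  right = ℕ.m⊔n≤o⇒n≤o (K ℕ.⊔ L) (M ℕ.⊔ N)

infixl 7 _*ℝ_
_*ℝ_ : ℝ → ℝ → ℝ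
x *ℝ y = mkℝ (λ n → seq x n * seq y n) λ ε 0<ε →
  let A , 0<A , K , boundˣ = eventually-bounded (cauchy x)
      B , 0<B , L , boundʸ = eventually-bounded (cauchy y)
      η , 0<η , eq = scale 0<ε (+-pos 0<A 0<B)
      M , closeˣ = cauchy x η 0<η
      N , closeʸ = cauchy y η 0<η
  in K ℕ.⊔ L ℕ.⊔ (M ℕ.⊔ N) ,
     subst (λ e → CloseFrom (λ n → seq x n * seq y n) e (K ℕ.⊔ L ℕ.⊔ (M ℕ.⊔ N))) eq
       (product-closeFrom {seq x} {seq y} 0<A 0<B boundˣ boundʸ closeˣ closeʸ)

tail-pos : ∀ y ((δ , _ , N , _) : 0ℝ <ℝ y) n → δ ≤ seq y (N ℕ.+ n)
tail-pos y (δ , _ , N , bound) n =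
  subst (_≤ _) (+-identityˡ δ) (bound (N ℕ.+ n) (ℕ.m≤m+n N n))

inverse-close : ∀ {ε δ} a b u v → 0ℚ < ε → 0ℚ < δ → δ ≤ a → δ ≤ b →
  0ℚ < u → 0ℚ < v → a * u ≡ 1ℚ → b * v ≡ 1ℚ →
  ∣ b - a ∣ < ε * (δ * δ) → ∣ u - v ∣ < ε
inverse-close {ε} {δ} a b u v 0<ε 0<δ δ≤a δ≤b 0<u 0<v au≡1 bv≡1 ba = begin-strict
  ∣ u - v ∣
    ≡⟨ cong ∣_∣ (cong₂ _-_ (sym (*-identityˡ u)) (sym (*-identityˡ v))) ⟩
  ∣ 1ℚ * u - 1ℚ * v ∣
    ≡⟨ cong ∣_∣ (cong₂ (λ s t → s * u - t * v) (sym bv≡1) (sym au≡1)) ⟩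
  ∣ (b * v) * u - (a * u) * v ∣
    ≡⟨ cong ∣_∣ (inverse-diff a b u v) ⟩
  ∣ (b - a) * (u * v) ∣
    ≡⟨ ∣p*q∣≡∣p∣*∣q∣ (b - a) (u * v) ⟩
  ∣ b - a ∣ * ∣ u * v ∣
    ≡⟨ cong (∣ b - a ∣ *_) (0≤p⇒∣p∣≡p (<⇒≤ 0<uv)) ⟩
  ∣ b - a ∣ * (u * v)
    <⟨ *-monoˡ-<-pos (u * v) {{ℚ.positive 0<uv}} ba ⟩
  ε * (δ * δ) * (u * v)
    ≤⟨ *-monoʳ-≤-nonNeg (u * v) {{ℚ.nonNegative (<⇒≤ 0<uv)}}
         (*-monoˡ-≤-nonNeg ε {{ℚ.nonNegative (<⇒≤ 0<ε)}}
           (*-mono-≤-nonNeg (≤-trans (<⇒≤ 0<δ) δ≤a) (<⇒≤ 0<δ) δ≤a δ≤b)) ⟩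
  ε * (a * b) * (u * v)
    ≡⟨ regroup ε a b u v ⟩
  ε * ((a * u) * (b * v))
    ≡⟨ cong₂ (λ s t → ε * (s * t)) au≡1 bv≡1 ⟩
  ε * 1ℚ
    ≡⟨ *-identityʳ ε ⟩
  ε ∎
  where
  open ≤-Reasoning
  0<uv : 0ℚ < u * v
  0<uv = *-pos 0<u 0<v

-- The witness N of positivity gives 0 < y_{N+n} for every n, so the inverse is
-- taken along the shifted sequence.
inverse : (y : ℝ) → 0ℝ <ℝ y → ℝ
inverse y y>0@(δ , 0<δ , N , _) = mkℝ z proof
  where
  δ≤y : ∀ n → δ ≤ seq y (N ℕ.+ n)
  δ≤y = tail-pos y y>0
  0<y : ∀ n → 0ℚ < seq y (N ℕ.+ n)
  0<y n = <-≤-trans 0<δ (δ≤y n)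
  z : ℕ → ℚ
  z n = (1/ seq y (N ℕ.+ n)) {{ℚ.>-nonZero (0<y n)}}
  proof : Cauchy z
  proof ε 0<ε with cauchy y (ε * (δ * δ)) (*-pos 0<ε (*-pos 0<δ 0<δ))
  ... | M , close = M , λ m n M≤m M≤n →
    inverse-close (seq y (N ℕ.+ m)) (seq y (N ℕ.+ n)) (z m) (z n) 0<ε 0<δ (δ≤y m) (δ≤y n)
      (1/-pos (0<y m)) (1/-pos (0<y n))
      (*-inverseʳ (seq y (N ℕ.+ m)) {{ℚ.>-nonZero (0<y m)}})
      (*-inverseʳ (seq y (N ℕ.+ n)) {{ℚ.>-nonZero (0<y n)}})
      (close (N ℕ.+ n) (N ℕ.+ m) (ℕ.≤-trans M≤n (ℕ.m≤n+m n N)) (ℕ.≤-trans M≤m (ℕ.m≤n+m m N)))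

infixl 7 _/_[_]
_/_[_] : (x y : ℝ) → 0ℝ <ℝ y → ℝ
x / y [ y>0 ] = x *ℝ inverse y y>0

-- harmonic a l = 1/(a+1) + 1/(a+2) + ⋯ + 1/(a+l)
harmonic : ℕ → ℕ → ℚ
harmonic a zero    = 0ℚ
harmonic a (suc l) = ℤ.+ 1 ℚ./ suc a + harmonic (suc a) l

recip : ℕ → ℚ
recip a = ℤ.+ 1 ℚ./ suc a

recip-form : ∀ a → recip a ≡ mkℚ (ℤ.+ 1) a (1-coprimeTo (suc a))
recip-form a = normalize-coprime (1-coprimeTo (suc a))

recip-pos : ∀ a → 0ℚ < recip a
recip-pos a = subst (0ℚ <_) (sym (recip-form a)) (positive⁻¹ _)

recip-anti : ∀ {a b} → a ℕ.≤ b → recip b ≤ recip a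
recip-anti {a} {b} a≤b = subst₂ _≤_ (sym (recip-form b)) (sym (recip-form a))
  (*≤* (ℤ.*-monoˡ-≤-nonNeg (ℤ.+ 1) (ℤ.+≤+ (s≤s a≤b))))

recip-archimedean : ∀ ε → 0ℚ < ε → ∃[ K ] recip K < ε
recip-archimedean (mkℚ (ℤ.+ zero) d _) (ℚ.*<* (ℤ.+<+ ()))
recip-archimedean (mkℚ ℤ.-[1+ _ ] d _) (ℚ.*<* ())
recip-archimedean (mkℚ ℤ.+[1+ p ] d c) _ = suc d , subst (_< mkℚ ℤ.+[1+ p ] d c)
  (sym (recip-form (suc d)))
  (ℚ.*<* (ℤ.+<+ (subst (ℕ._< suc p ℕ.* suc (suc d)) (sym (ℕ.*-identityˡ (suc d)))
    (ℕ.≤-trans ℕ.≤-refl (ℕ.m≤m+n (suc (suc d)) (p ℕ.* suc (suc d)))))))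

copies : ℕ → ℚ → ℚ
copies zero    c = 0ℚ
copies (suc l) c = c + copies l c

ι : ℕ → ℚ
ι n = mkℚ (ℤ.+ n) 0 (coprime-sym (1-coprimeTo n))

ι-suc : ∀ n → ι (suc n) ≡ 1ℚ + ι n
ι-suc n = toℚᵘ-injective (ℚᵘ.≃-trans
  (ℚᵘ.*≡* (cong (λ t → (ℤ.+ 1 ℤ.+ t) ℤ.* ℤ.+ 1) (sym (ℤ.*-identityʳ (ℤ.+ n)))))
  (ℚᵘ.≃-sym (toℚᵘ-homo-+ 1ℚ (ι n))))

copies-ι : ∀ l c → copies l c ≡ ι l * c
copies-ι zero    c = sym (*-zeroˡ c)
copies-ι (suc l) c = trans (cong (c +_) (copies-ι l c))
  (trans (one-more c (ι l))
         (cong (_* c) (sym (ι-suc l))))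

copies-recip : ∀ a D → copies (suc D) (recip (D ℕ.+ a ℕ.* suc D)) ≡ recip a
copies-recip a D = begin
  copies (suc D) (recip b)                              ≡⟨ copies-ι (suc D) (recip b) ⟩
  ι (suc D) * recip b                                   ≡⟨ cong (ι (suc D) *_) (recip-form b) ⟩
  ι (suc D) * mkℚ (ℤ.+ 1) b (1-coprimeTo (suc b))       ≡⟨ toℚᵘ-injective (ℚᵘ.≃-trans
    (toℚᵘ-homo-* (ι (suc D)) (mkℚ (ℤ.+ 1) b (1-coprimeTo (suc b))))
    (ℚᵘ.*≡* (cong ℤ.+_ lemma))) ⟩
  mkℚ (ℤ.+ 1) a (1-coprimeTo (suc a))                   ≡⟨ sym (recip-form a) ⟩
  recip a                                               ∎
  where
  open ≡-Reasoning
  b = D ℕ.+ a ℕ.* suc D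
  lemma : suc D ℕ.* 1 ℕ.* suc a ≡ 1 ℕ.* (1 ℕ.* (suc a ℕ.* suc D))
  lemma = trans (cong (ℕ._* suc a) (ℕ.*-identityʳ (suc D)))
    (trans (ℕ.*-comm (suc D) (suc a))
      (sym (trans (ℕ.*-identityˡ _) (ℕ.*-identityˡ _))))

harmonic-≥ : ∀ {c} a l → (∀ i → i ℕ.< a ℕ.+ l → c ≤ recip i) → copies l c ≤ harmonic a l
harmonic-≥ a zero    h = ≤-refl
harmonic-≥ a (suc l) h = +-mono-≤
  (h a (ℕ.m<m+n a (s≤s z≤n)))
  (harmonic-≥ (suc a) l λ i i< → h i (subst (i ℕ.<_) (sym (ℕ.+-suc a l)) i<))

harmonic-≤ : ∀ {c} a l → (∀ i → a ℕ.≤ i → recip i ≤ c) → harmonic a l ≤ copies l c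
harmonic-≤ a zero    h = ≤-refl
harmonic-≤ a (suc l) h = +-mono-≤ (h a ℕ.≤-refl)
  (harmonic-≤ (suc a) l λ i a<i → h i (ℕ.<⇒≤ a<i))

harmonic-++ : ∀ a k l → harmonic a (k ℕ.+ l) ≡ harmonic a k + harmonic (k ℕ.+ a) l
harmonic-++ a zero    l = sym (+-identityˡ _)
harmonic-++ a (suc k) l = trans
  (cong (recip a +_) (trans (harmonic-++ (suc a) k l)
    (cong (λ t → harmonic (suc a) k + harmonic t l) (ℕ.+-suc k a))))
  (sym (+-assoc (recip a) (harmonic (suc a) k) _))

harmonic-nonNeg : ∀ a l → 0ℚ ≤ harmonic a l
harmonic-nonNeg a zero    = ≤-refl
harmonic-nonNeg a (suc l) = +-mono-≤ (<⇒≤ (recip-pos a)) (harmonic-nonNeg (suc a) l)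

harmonic-anti : ∀ a l → harmonic (suc a) l ≤ harmonic a l
harmonic-anti a zero    = ≤-refl
harmonic-anti a (suc l) = +-mono-≤ (recip-anti (ℕ.n≤1+n a)) (harmonic-anti (suc a) l)

harmonic-suc : ∀ a l → harmonic a l ≤ recip a + harmonic (suc a) l
harmonic-suc a l = ≤-trans (harmonic-anti′ l) (≤-reflexive refl)
  where
  open ≤-Reasoning
  harmonic-anti′ : ∀ l → harmonic a l ≤ harmonic a (suc l)
  harmonic-anti′ l = begin
    harmonic a l                              ≡⟨ sym (+-identityʳ _) ⟩
    harmonic a l + 0ℚ                         ≤⟨ +-monoʳ-≤ (harmonic a l) (harmonic-nonNeg (l ℕ.+ a) 1) ⟩
    harmonic a l + harmonic (l ℕ.+ a) 1       ≡⟨ sym (harmonic-++ a l 1) ⟩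
    harmonic a (l ℕ.+ 1)                      ≡⟨ cong (harmonic a) (ℕ.+-comm l 1) ⟩
    harmonic a (suc l)                        ∎

-- Subdividing every cell into suc D cells raises the right-endpoint sum ...
refine-lower : ∀ a l D → harmonic a l ≤ harmonic (a ℕ.* suc D) (l ℕ.* suc D)
refine-lower a zero    D = ≤-refl
refine-lower a (suc l) D = begin
  recip a + harmonic (suc a) l
    ≤⟨ +-mono-≤ block (refine-lower (suc a) l D) ⟩
  harmonic (a ℕ.* suc D) (suc D) + harmonic (suc a ℕ.* suc D) (l ℕ.* suc D)
    ≡⟨ sym (harmonic-++ (a ℕ.* suc D) (suc D) (l ℕ.* suc D)) ⟩
  harmonic (a ℕ.* suc D) (suc l ℕ.* suc D) ∎
  where
  open ≤-Reasoning
  block : recip a ≤ harmonic (a ℕ.* suc D) (suc D)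
  block = subst (_≤ harmonic (a ℕ.* suc D) (suc D)) (copies-recip a D)
    (harmonic-≥ (a ℕ.* suc D) (suc D) λ i i< → recip-anti
      (ℕ.≤-pred (subst (suc i ℕ.≤_) (ℕ.+-comm (a ℕ.* suc D) (suc D)) i<)))

-- ... and lowers the left-endpoint sum.
refine-upper : ∀ a l D → harmonic (D ℕ.+ a ℕ.* suc D) (l ℕ.* suc D) ≤ harmonic a l
refine-upper a zero    D = ≤-refl
refine-upper a (suc l) D = begin
  harmonic (D ℕ.+ a ℕ.* suc D) (suc l ℕ.* suc D)
    ≡⟨ harmonic-++ (D ℕ.+ a ℕ.* suc D) (suc D) (l ℕ.* suc D) ⟩
  harmonic (D ℕ.+ a ℕ.* suc D) (suc D) + harmonic (suc D ℕ.+ (D ℕ.+ a ℕ.* suc D)) (l ℕ.* suc D)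
    ≡⟨ cong (λ t → harmonic (D ℕ.+ a ℕ.* suc D) (suc D) + harmonic t (l ℕ.* suc D))
         (sym (ℕ.+-suc D (D ℕ.+ a ℕ.* suc D))) ⟩
  harmonic (D ℕ.+ a ℕ.* suc D) (suc D) + harmonic (D ℕ.+ suc a ℕ.* suc D) (l ℕ.* suc D)
    ≤⟨ +-mono-≤ block (refine-upper (suc a) l D) ⟩
  recip a + harmonic (suc a) l ∎
  where
  open ≤-Reasoning
  block : harmonic (D ℕ.+ a ℕ.* suc D) (suc D) ≤ recip a
  block = subst (harmonic (D ℕ.+ a ℕ.* suc D) (suc D) ≤_) (copies-recip a D)
    (harmonic-≤ (D ℕ.+ a ℕ.* suc D) (suc D) λ i → recip-anti)

-- The right-endpoint Riemann sum of ∫₁^m dt/t with h = 1/(N+1) as the mesh: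
-- the j-th of its (m-1)(N+1) terms is h · 1/(1 + j h) = 1/(N+1+j).
riemann-sum : ℕ → ℕ → ℚ
riemann-sum m N = harmonic (suc N) ((m ℕ.∸ 1) ℕ.* suc N)

riemann-sum-≤ : ∀ m M N → riemann-sum m M ≤ recip N + riemann-sum m N
riemann-sum-≤ m M N = begin
  harmonic (suc M) (l ℕ.* suc M)
    ≤⟨ refine-lower (suc M) (l ℕ.* suc M) N ⟩
  harmonic (suc M ℕ.* suc N) (l ℕ.* suc M ℕ.* suc N)
    ≡⟨ cong₂ harmonic (ℕ.*-comm (suc M) (suc N)) comm ⟩
  harmonic (suc N ℕ.* suc M) (l ℕ.* suc N ℕ.* suc M)
    ≤⟨ harmonic-anti _ (l ℕ.* suc N ℕ.* suc M) ⟩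
  harmonic (M ℕ.+ N ℕ.* suc M) (l ℕ.* suc N ℕ.* suc M)
    ≤⟨ refine-upper N (l ℕ.* suc N) M ⟩
  harmonic N (l ℕ.* suc N)
    ≤⟨ harmonic-suc N (l ℕ.* suc N) ⟩
  recip N + harmonic (suc N) (l ℕ.* suc N) ∎
  where
  open ≤-Reasoning
  l = m ℕ.∸ 1
  comm : l ℕ.* suc M ℕ.* suc N ≡ l ℕ.* suc N ℕ.* suc M
  comm = trans (ℕ.*-assoc l (suc M) (suc N))
    (trans (cong (l ℕ.*_) (ℕ.*-comm (suc M) (suc N))) (sym (ℕ.*-assoc l (suc N) (suc M))))

riemann-sum-cauchy : ∀ m → Cauchy (riemann-sum m)
riemann-sum-cauchy m ε 0<ε with recip-archimedean ε 0<ε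
... | K , K<ε = K , close
  where
  open ≤-Reasoning
  one-sided : ∀ M N → K ℕ.≤ N → riemann-sum m M - riemann-sum m N < ε
  one-sided M N K≤N = begin-strict
    riemann-sum m M - riemann-sum m N
      ≤⟨ +-monoˡ-≤ (- riemann-sum m N) (riemann-sum-≤ m M N) ⟩
    (recip N + riemann-sum m N) - riemann-sum m N
      ≡⟨ cancel (recip N) (riemann-sum m N) ⟩
    recip N   ≤⟨ recip-anti K≤N ⟩
    recip K   <⟨ K<ε ⟩
    ε         ∎
  close : ∀ M N → K ℕ.≤ M → K ℕ.≤ N → ∣ riemann-sum m M - riemann-sum m N ∣ < ε
  close M N K≤M K≤N with ∣p∣≡p∨∣p∣≡-p (riemann-sum m M - riemann-sum m N)
  ... | inj₁ eq = subst (_< ε) (sym eq) (one-sided M N K≤N)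
  ... | inj₂ eq = subst (_< ε)
    (sym (trans eq (swap-diff (riemann-sum m M) (riemann-sum m N))))
    (one-sided N M K≤M)

-- log m = ∫₁^m dt/t for m ≥ 1; log 0 = 0 is a junk value.
log : ℕ → ℝ
log m = mkℝ (riemann-sum m) (riemann-sum-cauchy m)

log-pos : ∀ {m} → 1 ℕ.< m → 0ℝ <ℝ log m
log-pos {suc (suc l)} (s≤s (s≤s z≤n)) = recip 1 , recip-pos 1 , 0 , λ n _ → begin
  0ℚ + recip 1                        ≡⟨ +-identityˡ (recip 1) ⟩
  recip 1                             ≡⟨ sym (+-identityʳ (recip 1)) ⟩
  recip 1 + 0ℚ                        ≤⟨ +-monoʳ-≤ (recip 1) (harmonic-nonNeg 2 l) ⟩
  recip 1 + harmonic 2 l              ≤⟨ refine-lower 1 (suc l) n ⟩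
  harmonic (1 ℕ.* suc n) (suc l ℕ.* suc n)
    ≡⟨ cong (λ t → harmonic t (suc l ℕ.* suc n)) (ℕ.*-identityˡ (suc n)) ⟩
  harmonic (suc n) (suc l ℕ.* suc n)  ∎
  where open ≤-Reasoning

{-# OPTIONS --safe #-}

-- The digits of W are below r, so W < r^(n+1), and log W < (n+1) log r with a gap
-- coming from the cells between W and W+1.  On the Riemann sums S of log,
-- S_{ab}(j) = S_a(j) + S_b(a(j+1) − 1) exactly, and S_m(j) exceeds S_m(K) by at most
-- 1/(K+1), whatever j is; hence S_{r^(n+1)}(j) ≤ (n+1)(S_r(K) + 1/(K+1)), where the
-- error is absorbed by the gap for large K.
module Submission where

open import Data.Nat.Base using (ℕ; _≤_; _<_; _⊔_)
open import Defs

open import Data.Nat.Base as ℕ using (zero; suc; z≤n; s≤s)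
import Data.Nat.Properties as ℕ
import Data.Nat.Tactic.RingSolver as ℕ-Solver
import Data.Integer.Base as ℤ
open import Data.Fin.Base as Fin using (Fin; toℕ)
open import Data.Fin.Properties using (toℕ<n)
open import Data.Product using (∃-syntax; _×_; _,_)
open import Data.Rational.Base as ℚ using (ℚ; 0ℚ; 1ℚ; ½; 1/_)
import Data.Rational.Properties as ℚ
open import Data.Rational.Solver using (module +-*-Solver)
open import Data.Nat.Coprimality using (1-coprimeTo) renaming (sym to coprime-sym)
open import Algebra.Properties.Monoid.Sum ℕ.+-0-monoid using (sum; sum-cong-≗)
open import Algebra.Properties.Semiring.Sum ℕ.+-*-semiring using (*-distribˡ-sum)
open import Relation.Binary.PropositionalEquality
  using (_≡_; refl; sym; trans; cong; cong₂; subst)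
open +-*-Solver using (solve; _:=_; _:+_; _:*_; _:-_; con)

-- Horner's scheme: splitting off the lowest digit leaves r times a shorter digit sum, to which
-- induction applies.
digit-sum-< : ∀ r m (b : Fin m → Fin r) → sum (λ i → toℕ (b i) ℕ.* r ℕ.^ toℕ i) < r ℕ.^ m
digit-sum-< r zero    b = s≤s z≤n
digit-sum-< r (suc m) b = begin-strict
  toℕ (b Fin.zero) ℕ.* 1 ℕ.+ sum (λ i → toℕ (b (Fin.suc i)) ℕ.* (r ℕ.* r ℕ.^ toℕ i))
    ≡⟨ cong₂ ℕ._+_ (ℕ.*-identityʳ _) (trans
         (sum-cong-≗ λ i → rotate (toℕ (b (Fin.suc i))) r (r ℕ.^ toℕ i))
         (sym (*-distribˡ-sum r (λ i → toℕ (b (Fin.suc i)) ℕ.* r ℕ.^ toℕ i)))) ⟩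
  toℕ (b Fin.zero) ℕ.+ r ℕ.* tail
    <⟨ ℕ.+-monoˡ-< (r ℕ.* tail) (toℕ<n (b Fin.zero)) ⟩
  r ℕ.+ r ℕ.* tail
    ≡⟨ sym (ℕ.*-suc r tail) ⟩
  -- The induction hypothesis `tail < r ^ m`, read over the integers as `suc tail ≤ r ^ m`, makes
  -- room for the extra r.
  r ℕ.* suc tail
    ≤⟨ ℕ.*-monoʳ-≤ r (digit-sum-< r m (λ i → b (Fin.suc i))) ⟩
  r ℕ.* r ℕ.^ m ∎
  where
  open ℕ.≤-Reasoning
  tail : ℕ
  tail = sum (λ i → toℕ (b (Fin.suc i)) ℕ.* r ℕ.^ toℕ i)
  rotate : ∀ x y z → x ℕ.* (y ℕ.* z) ≡ y ℕ.* (x ℕ.* z)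
  rotate = ℕ-Solver.solve-∀

<-^-of-leadingExponent : ∀ {r W n} → IsLeadingExponent r W n → W < r ℕ.^ suc n
<-^-of-leadingExponent {r} {W} {n} (b , _ , W≡) =
  subst (_< r ℕ.^ suc n) (sym W≡) (digit-sum-< r (suc n) b)

-- With A = `suc a` and B = `suc b`, the terms 1/(j+2), ..., 1/(AB(j+1)) are cut after 1/(A(j+1)).
-- The later ones form the sum for B with mesh 1/(A(j+1)), whose index is A(j+1) - 1. Thus log(AB) =
-- log A + log B already holds at finite mesh.
riemann-sum-* : ∀ a b j → riemann-sum (suc a ℕ.* suc b) j
                        ≡ riemann-sum (suc a) j ℚ.+ riemann-sum (suc b) (j ℕ.+ a ℕ.* suc j)
riemann-sum-* a b j = trans
  (cong (harmonic (suc j)) (cells a b j))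
  (trans (harmonic-++ (suc j) (a ℕ.* suc j) (b ℕ.* suc (j ℕ.+ a ℕ.* suc j)))
    (cong (λ t → harmonic (suc j) (a ℕ.* suc j) ℚ.+ harmonic t (b ℕ.* suc (j ℕ.+ a ℕ.* suc j)))
      (ℕ.+-comm (a ℕ.* suc j) (suc j))))
  where
  cells : ∀ a b j → (b ℕ.+ a ℕ.* suc b) ℕ.* suc j
                  ≡ a ℕ.* suc j ℕ.+ b ℕ.* suc (j ℕ.+ a ℕ.* suc j)
  cells = ℕ-Solver.solve-∀

-- Each factor split off by `riemann-sum-*` comes with its own mesh; `riemann-sum-≤` brings all of
-- them to the single mesh index K, at a cost of `recip K` each.
riemann-sum-^ : ∀ r n j K → 1 ≤ r →
  riemann-sum (r ℕ.^ n) j ℚ.≤ copies n (recip K ℚ.+ riemann-sum r K)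
riemann-sum-^ r       zero    j K _ = ℚ.≤-refl
riemann-sum-^ (suc a) (suc n) j K 1≤r
  -- Positivity excludes a zero power and exposes the successor that `riemann-sum-*` expects. The
  -- induction hypothesis is kept for every index, since the mesh changes.
  with suc a ℕ.^ n | ℕ.m^n>0 (suc a) n | (λ i → riemann-sum-^ (suc a) n i K 1≤r)
... | suc b | _ | bound = begin
  riemann-sum (suc a ℕ.* suc b) j
    ≡⟨ riemann-sum-* a b j ⟩
  riemann-sum (suc a) j ℚ.+ riemann-sum (suc b) (j ℕ.+ a ℕ.* suc j)
    ≤⟨ ℚ.+-mono-≤ (riemann-sum-≤ (suc a) j K) (bound (j ℕ.+ a ℕ.* suc j)) ⟩
  copies (suc n) (recip K ℚ.+ riemann-sum (suc a) K) ∎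
  where open ℚ.≤-Reasoning

-- The terms past m form a right-endpoint sum over [m, m′]. By `refine-lower` it is at least the sum
-- with mesh 1, whose first term is 1/(m+1); so the gap is uniform in j.
riemann-sum-gap : ∀ {m m′} j → 1 ≤ m → m < m′ →
  riemann-sum m j ℚ.+ recip m ℚ.≤ riemann-sum m′ j
riemann-sum-gap {suc w} j _ (s≤s w<) with ℕ.m≤n⇒∃[o]m+o≡n w<
... | l , refl = begin
  harmonic (suc j) (w ℕ.* suc j) ℚ.+ recip (suc w)
    ≡⟨ cong (harmonic (suc j) (w ℕ.* suc j) ℚ.+_) (sym (ℚ.+-identityʳ (recip (suc w)))) ⟩
  harmonic (suc j) (w ℕ.* suc j) ℚ.+ (recip (suc w) ℚ.+ 0ℚ)
    ≤⟨ ℚ.+-monoʳ-≤ (harmonic (suc j) (w ℕ.* suc j)) (ℚ.+-monoʳ-≤ (recip (suc w)) (harmonic-nonNeg (suc (suc w)) l)) ⟩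
  harmonic (suc j) (w ℕ.* suc j) ℚ.+ harmonic (suc w) (suc l)
    ≤⟨ ℚ.+-monoʳ-≤ (harmonic (suc j) (w ℕ.* suc j)) (refine-lower (suc w) (suc l) j) ⟩
  harmonic (suc j) (w ℕ.* suc j) ℚ.+ harmonic (suc w ℕ.* suc j) (suc l ℕ.* suc j)
    ≡⟨ cong (λ t → harmonic (suc j) (w ℕ.* suc j) ℚ.+ harmonic t (suc l ℕ.* suc j))
         (ℕ.+-comm (suc j) (w ℕ.* suc j)) ⟩
  harmonic (suc j) (w ℕ.* suc j) ℚ.+ harmonic (w ℕ.* suc j ℕ.+ suc j) (suc l ℕ.* suc j)
    ≡⟨ sym (harmonic-++ (suc j) (w ℕ.* suc j) (suc l ℕ.* suc j)) ⟩
  harmonic (suc j) (w ℕ.* suc j ℕ.+ suc l ℕ.* suc j)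
    ≡⟨ cong (harmonic (suc j)) (cells w l j) ⟩
  harmonic (suc j) ((suc w ℕ.+ l) ℕ.* suc j) ∎
  where
  open ℚ.≤-Reasoning
  cells : ∀ w l j → w ℕ.* suc j ℕ.+ suc l ℕ.* suc j ≡ (suc w ℕ.+ l) ℕ.* suc j
  cells = ℕ-Solver.solve-∀

ι-pos : ∀ n → 0ℚ ℚ.< ι (suc n)
ι-pos n = ℚ.positive⁻¹ (ι (suc n))

absorb-half-gap : ∀ {x p i ρ η s} → 0ℚ ℚ.≤ i → i ℚ.* η ≡ p ℚ.* ½ → ρ ℚ.≤ η →
  x ℚ.+ p ℚ.≤ i ℚ.* (ρ ℚ.+ s) → x ℚ.+ p ℚ.* ½ ℚ.≤ i ℚ.* s
absorb-half-gap {x} {p} {i} {ρ} {η} {s} 0≤i iη≡p½ ρ≤η x+p≤ = begin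
  x ℚ.+ p ℚ.* ½                        ≡⟨ halves x p ⟩
  (x ℚ.+ p) ℚ.- p ℚ.* ½                ≤⟨ ℚ.+-monoˡ-≤ (ℚ.- (p ℚ.* ½)) x+p≤ ⟩
  i ℚ.* (ρ ℚ.+ s) ℚ.- p ℚ.* ½          ≡⟨ cong (λ t → i ℚ.* (ρ ℚ.+ s) ℚ.- t) (sym iη≡p½) ⟩
  i ℚ.* (ρ ℚ.+ s) ℚ.- i ℚ.* η          ≤⟨ ℚ.+-monoˡ-≤ (ℚ.- (i ℚ.* η))
                                            (ℚ.*-monoˡ-≤-nonNeg i {{ℚ.nonNegative 0≤i}}
                                              (ℚ.+-monoˡ-≤ s ρ≤η)) ⟩
  i ℚ.* (η ℚ.+ s) ℚ.- i ℚ.* η          ≡⟨ cancel η i s ⟩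
  i ℚ.* s                              ∎
  where
  open ℚ.≤-Reasoning
  halves : ∀ x p → x ℚ.+ p ℚ.* ½ ≡ (x ℚ.+ p) ℚ.- p ℚ.* ½
  halves = solve 2 (λ x p → x :+ p :* con ½ := (x :+ p) :- p :* con ½) refl
  cancel : ∀ η i s → i ℚ.* (η ℚ.+ s) ℚ.- i ℚ.* η ≡ i ℚ.* s
  cancel = solve 3 (λ η i s → i :* (η :+ s) :- i :* η := i :* s) refl

riemann-sum-separated : ∀ r n m → 1 ≤ r → 1 ≤ m → m < r ℕ.^ suc n →
  ∃[ g ] (0ℚ ℚ.< g) × ∃[ J ] ∀ j K → J ≤ K →
    riemann-sum m j ℚ.+ g ℚ.≤ ι (suc n) ℚ.* riemann-sum r K
riemann-sum-separated r n m 1≤r 1≤m m< =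
  let 0<g = *-pos (recip-pos m) (ℚ.positive⁻¹ ½)
      -- n+1 errors of size at most η use up half of the gap 1/(m+1); the other half is g.
      η , 0<η , ιη≡g = scale 0<g (ι-pos n)
      J , J<η = recip-archimedean η 0<η
  in recip m ℚ.* ½ , 0<g , J , λ j K J≤K →
  absorb-half-gap {riemann-sum m j} {recip m} {ι (suc n)} {recip K} {η} {riemann-sum r K}
    (ℚ.<⇒≤ (ι-pos n)) ιη≡g (ℚ.≤-trans (recip-anti J≤K) (ℚ.<⇒≤ J<η))
    (ℚ.≤-trans (riemann-sum-gap j 1≤m m<)
      (subst (riemann-sum (r ℕ.^ suc n) j ℚ.≤_) (copies-ι (suc n) (recip K ℚ.+ riemann-sum r K))
        (riemann-sum-^ r (suc n) j K 1≤r)))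

-- Here u = 1/y and v = 1/B. Division turns the gap g into g/y, which varies along the sequence; the
-- upper bound B on y replaces it by the constant g/B.
quotient-gap : ∀ {x y q g B u v} → 0ℚ ℚ.≤ g → 0ℚ ℚ.≤ u → 0ℚ ℚ.≤ v →
  y ℚ.* u ≡ 1ℚ → B ℚ.* v ≡ 1ℚ → y ℚ.≤ B →
  x ℚ.+ g ℚ.≤ q ℚ.* y → x ℚ.* u ℚ.+ g ℚ.* v ℚ.≤ q
quotient-gap {x} {y} {q} {g} {B} {u} {v} 0≤g 0≤u 0≤v yu≡1 Bv≡1 y≤B x+g≤qy = begin
  x ℚ.* u ℚ.+ g ℚ.* v
    ≤⟨ ℚ.+-monoʳ-≤ (x ℚ.* u) (ℚ.*-monoˡ-≤-nonNeg g {{ℚ.nonNegative 0≤g}} v≤u) ⟩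
  x ℚ.* u ℚ.+ g ℚ.* u
    ≡⟨ sym (ℚ.*-distribʳ-+ u x g) ⟩
  (x ℚ.+ g) ℚ.* u
    ≤⟨ ℚ.*-monoʳ-≤-nonNeg u {{ℚ.nonNegative 0≤u}} x+g≤qy ⟩
  (q ℚ.* y) ℚ.* u
    ≡⟨ ℚ.*-assoc q y u ⟩
  q ℚ.* (y ℚ.* u)
    ≡⟨ cong (q ℚ.*_) yu≡1 ⟩
  q ℚ.* 1ℚ
    ≡⟨ ℚ.*-identityʳ q ⟩
  q ∎
  where
  open ℚ.≤-Reasoning
  rotate : ∀ a b c → (a ℚ.* b) ℚ.* c ≡ (a ℚ.* c) ℚ.* b
  rotate = solve 3 (λ a b c → (a :* b) :* c := (a :* c) :* b) refl
  v≤u : v ℚ.≤ u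
  v≤u = begin
    v                    ≡⟨ sym (ℚ.*-identityˡ v) ⟩
    1ℚ ℚ.* v             ≡⟨ cong (ℚ._* v) (sym yu≡1) ⟩
    (y ℚ.* u) ℚ.* v      ≤⟨ ℚ.*-monoʳ-≤-nonNeg v {{ℚ.nonNegative 0≤v}}
                              (ℚ.*-monoʳ-≤-nonNeg u {{ℚ.nonNegative 0≤u}} y≤B) ⟩
    (B ℚ.* u) ℚ.* v      ≡⟨ rotate B u v ⟩
    (B ℚ.* v) ℚ.* u      ≡⟨ cong (ℚ._* u) Bv≡1 ⟩
    1ℚ ℚ.* u             ≡⟨ ℚ.*-identityˡ u ⟩
    u                    ∎

-- The index of y is left independent of that of x because division shifts the sequence of y.
/-<ℝ : ∀ x y (y>0 : 0ℝ <ℝ y) q →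
  (∃[ g ] (0ℚ ℚ.< g) × ∃[ J ] ∀ j K → J ≤ K → seq x j ℚ.+ g ℚ.≤ q ℚ.* seq y K) →
  (x / y [ y>0 ]) <ℝ fromℚ q
/-<ℝ x y y>0@(δ , 0<δ , N , _) q (g , 0<g , J , separated) =
  let B , 0<B , L , bounded = eventually-bounded {seq y} (cauchy y)
      B⁻¹ = (1/ B) {{ℚ.>-nonZero 0<B}}
  in g ℚ.* B⁻¹ , *-pos 0<g (1/-pos 0<B) , J ℕ.⊔ L , λ n p →
  quotient-gap {seq x n} {seq y (N ℕ.+ n)} {q} {g} {B} {seq (inverse y y>0) n} {B⁻¹}
    (ℚ.<⇒≤ 0<g) (ℚ.<⇒≤ (1/-pos (0<y n))) (ℚ.<⇒≤ (1/-pos 0<B))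
    (ℚ.*-inverseʳ (seq y (N ℕ.+ n)) {{ℚ.>-nonZero (0<y n)}})
    (ℚ.*-inverseʳ B {{ℚ.>-nonZero 0<B}})
    (subst (ℚ._≤ B) (ℚ.0≤p⇒∣p∣≡p (ℚ.<⇒≤ (0<y n)))
      (bounded (N ℕ.+ n) (ℕ.≤-trans (ℕ.m⊔n≤o⇒n≤o J L p) (ℕ.m≤n+m n N))))
    (separated n (N ℕ.+ n) (ℕ.≤-trans (ℕ.m⊔n≤o⇒m≤o J L p) (ℕ.m≤n+m n N)))
  where
  0<y : ∀ n → 0ℚ ℚ.< seq y (N ℕ.+ n)
  0<y n = ℚ.<-≤-trans 0<δ (tail-pos y y>0 n)

-- `fromℕ` uses normalising division, while `ι n` is written in lowest terms and so is its own
-- normal form.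
ι-fromℕ : ∀ n → ι n ≡ ℤ.+ n ℚ./ 1
ι-fromℕ n = sym (ℚ.normalize-coprime (coprime-sym (1-coprimeTo n)))

-ℝ1<fromℕ : ∀ x n → x <ℝ fromℚ (ι (suc n)) → x -ℝ 1ℝ <ℝ fromℕ n
-ℝ1<fromℕ x n (δ , 0<δ , N , bound) = δ , 0<δ , N , λ j N≤j → begin
  (seq x j ℚ.- 1ℚ) ℚ.+ δ   ≡⟨ shift (seq x j) δ ⟩
  (seq x j ℚ.+ δ) ℚ.- 1ℚ   ≤⟨ ℚ.+-monoˡ-≤ (ℚ.- 1ℚ) (bound j N≤j) ⟩
  ι (suc n) ℚ.- 1ℚ         ≡⟨ cong (ℚ._- 1ℚ) (ι-suc n) ⟩
  (1ℚ ℚ.+ ι n) ℚ.- 1ℚ      ≡⟨ drop (ι n) ⟩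
  ι n                      ≡⟨ ι-fromℕ n ⟩
  ℤ.+ n ℚ./ 1              ∎
  where
  open ℚ.≤-Reasoning
  shift : ∀ a d → (a ℚ.- 1ℚ) ℚ.+ d ≡ (a ℚ.+ d) ℚ.- 1ℚ
  shift = solve 2 (λ a d → (a :- con 1ℚ) :+ d := (a :+ d) :- con 1ℚ) refl
  drop : ∀ a → (1ℚ ℚ.+ a) ℚ.- 1ℚ ≡ a
  drop = solve 1 (λ a → (con 1ℚ :+ a) :- con 1ℚ := a) refl

corollary2p1 : ∀ (r k W n : ℕ) (1<r : 1 < r) → 1 ≤ k →
    IsVanDerWaerdenNumber r k W → r ⊔ k < W → IsLeadingExponent r W n →
    (log W / log r [ log-pos 1<r ]) -ℝ 1ℝ <ℝ fromℕ n
corollary2p1 r k W n 1<r _ (1≤W , _) _ lead =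
  -- The bound is proved as log W / log r < n+1, and the 1 is then moved across.
  -ℝ1<fromℕ (log W / log r [ log-pos 1<r ]) n
    (/-<ℝ (log W) (log r) (log-pos 1<r) (ι (suc n))
      (riemann-sum-separated r n W (ℕ.<⇒≤ 1<r) 1≤W (<-^-of-leadingExponent lead)))
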